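{- Let $p>23$ be a prime and let $f\in\mathbb{F}_p[x]$ be a non-constant polynomial. Regard $f$ as a function from $\mathbb{F}_p$ to the set of integers $\{0,1,\ldots,p-1\}$, and assume that $\sum_{x\in\mathbb{F}_p} f(x)=p$, where the sum is taken in $\mathbb{Z}$. Then $\deg(f)\ge \frac{p-1}{2}$.
   Context: $\mathbb{F}_p$ is the field with $p$ elements. Its elements are identified with the integers $\{0,1,\ldots,p-1\}$ (each element with its least non-negative representative); each value $f(x)$ is viewed as such an integer, so that the values of $f$ can be summed in $\mathbb{Z}$. -}

module Defs where

open import Data.Bool.Base using (if_then_else_)
open import Data.Fin.Base using (Fin; toℕ)
open import Data.Fin.Properties using (_≟_)
open import Data.List.Base using (List; []; _∷_)
open import Data.List.Relation.Unary.All using (all?)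
open import Data.Nat.Base using (ℕ; zero; suc; NonZero; _+_; _*_)
open import Data.Nat.DivMod using (_mod_)
open import Data.Product.Base using (∃-syntax)
open import Relation.Binary.PropositionalEquality.Core using (_≡_)
open import Relation.Nullary.Decidable.Core using (does)

-- 𝔽 p is the ring of integers modulo p on the least non-negative
-- representatives, so toℕ is the identification of its elements with
-- {0, 1, …, p - 1}.  It is a field exactly when p is prime.

𝔽 : ℕ → Set
𝔽 = Fin

module _ {p : ℕ} .{{_ : NonZero p}} where

  infixl 6 _+ₚ_
  infixl 7 _*ₚ_

  0ₚ : 𝔽 p
  0ₚ = 0 mod p

  _+ₚ_ : 𝔽 p → 𝔽 p → 𝔽 p
  x +ₚ y = (toℕ x + toℕ y) mod p

  _*ₚ_ : 𝔽 p → 𝔽 p → 𝔽 p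
  x *ₚ y = (toℕ x * toℕ y) mod p

-- A polynomial is its list of coefficients, constant term first.  Trailing
-- zeros are allowed, so equality of polynomials is _≋_ rather than _≡_.

𝔽[X] : ℕ → Set
𝔽[X] p = List (𝔽 p)

module _ {p : ℕ} .{{_ : NonZero p}} where

  infix 4 _≋_

  coeff : 𝔽[X] p → ℕ → 𝔽 p
  coeff []      _       = 0ₚ
  coeff (a ∷ f) zero    = a
  coeff (a ∷ f) (suc i) = coeff f i

  _≋_ : 𝔽[X] p → 𝔽[X] p → Set
  f ≋ g = ∀ i → coeff f i ≡ coeff g i

  const : 𝔽 p → 𝔽[X] p
  const c = c ∷ []

  Constant : 𝔽[X] p → Set
  Constant f = ∃[ c ] f ≋ const c

  -- The largest index of a nonzero coefficient, with the convention that the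
  -- zero polynomial has degree 0.
  deg : 𝔽[X] p → ℕ
  deg []      = 0
  deg (a ∷ f) = if does (all? (_≟ 0ₚ) f) then 0 else suc (deg f)

  eval : 𝔽[X] p → 𝔽 p → 𝔽 p
  eval []      x = 0ₚ
  eval (a ∷ f) x = a +ₚ x *ₚ eval f x

{-# OPTIONS --safe #-}
module Submission where

-- Let f have degree k with 0 < k < (p - 1) / 2, and let F be the monic polynomial
-- of degree p having each x as a root with multiplicity f(x).  Since
-- P = X ^ p - X vanishes everywhere and P / (X - x) is -1 at x and 0 elsewhere,
-- P F′ / F = Σ f(x) P / (X - x) is a polynomial of degree < p with the values of
-- - f, so that P F′ = - f F.  Comparing coefficients at p + m for m ≥ k gives
-- F′ₘ = - fₘ.  In particular F′ has no terms between X ^ k and X ^ p, so the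
-- coefficient at 2k + 1 < p reads 0 = fₖ Fₖ₊₁; hence Fₖ₊₁ = 0 and fₖ = - F′ₖ = 0.

open import Defs
open import Algebra.Bundles using (CommutativeRing)
open import Algebra.Consequences.Propositional using (comm∧idˡ⇒id; comm∧invʳ⇒inv; comm∧distrˡ⇒distrʳ)
import Algebra.Properties.CommutativeMonoid.Mult as CommutativeMonoidMult
import Algebra.Properties.CommutativeSemiring.Binomial as CommutativeSemiringBinomial
import Algebra.Properties.Group as GroupProperties
import Algebra.Properties.Monoid.Sum as MonoidSum
import Algebra.Properties.Ring as RingProperties
import Algebra.Properties.Semiring.Exp as SemiringExp
import Algebra.Properties.Semiring.Mult as SemiringMult
open import Data.Fin.Base using (Fin; zero; suc; toℕ; fromℕ; inject₁)
open import Data.Fin.Properties using (_≟_; toℕ-fromℕ; toℕ-fromℕ<; toℕ-inject₁; toℕ-injective; toℕ<n)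
open import Data.List.Base using (List; []; _∷_; _++_; foldr; length; map; allFin; replicate; concatMap)
open import Data.List.Membership.Propositional using (_∈_)
open import Data.List.Membership.Propositional.Properties using (∈-allFin)
open import Data.List.Properties using (map-cong; length-++; length-replicate; length-tabulate)
open import Data.List.Relation.Unary.All as All using (All; []; _∷_; all?)
open import Data.List.Relation.Unary.AllPairs using (AllPairs; []; _∷_)
open import Data.List.Relation.Unary.Any using (here; there)
open import Data.List.Relation.Unary.Unique.Propositional using (Unique)
open import Data.List.Relation.Unary.Unique.Propositional.Properties using (allFin⁺)
open import Data.Maybe.Base using (nothing)
open import Data.Nat.Base as ℕ using (ℕ; zero; suc; NonZero; _∸_; _<_; _≤_; _≥_; z≤n; s≤s)
open import Data.Nat.Combinatorics using (_C_; k>n⇒nCk≡0; nC1≡n; nCn≡1; nCk+nC[k+1]≡[n+1]C[k+1])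
open import Data.Nat.Divisibility using (_∣_; divides; _∣0; ∣-refl; m∣m*n; >⇒∤; m%n≡0⇒n∣m; n∣m⇒m%n≡0)
open import Data.Nat.DivMod using (_/_; _%_; _mod_; m%n<n; m<n⇒m%n≡m; m/n*n≤m; %-distribˡ-+; %-distribˡ-*)
open import Data.Nat.ListAction using (sum)
open import Data.Nat.Primality using (Prime; ¬prime[0]; euclidsLemma)
import Data.Nat.Properties as ℕ
open import Data.Product.Base using (_,_)
open import Data.Sum.Base as Sum using (_⊎_; inj₁; inj₂)
open import Level using (0ℓ; _⊔_)
open import Relation.Binary.PropositionalEquality as ≡ using (_≡_; _≢_)
import Relation.Binary.Reasoning.Setoid as SetoidReasoning
open import Relation.Nullary using (¬_; yes; no; contradiction)
open import Tactic.RingSolver using (solve-∀)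
open import Tactic.RingSolver.Core.AlmostCommutativeRing using (AlmostCommutativeRing; fromCommutativeRing)

-- The numbers f(x) are used in two roles: as integers they are multiplicities, so that the range
-- sum is the degree of F; modulo p they are the values of f. The logarithmic derivative links the
-- roles, because it turns a multiplicity into a factor in the field. Clearing its denominators with
-- P rather than with the product over the roots that occur makes the multiplier independent of f
-- and sparse: each coefficient of P F′ involves at most two coefficients of F′. Hence one equation
-- can be read at both ends. Above p it compares F′ with f, as F starts from the top with 1; below p
-- it shows F′ alone. A vanishing coefficient of F′ gives one of F only at indices that p does not
-- divide. So between k + 1 and p the series F has a gap, and in f F the coefficient at 2k + 1
-- reduces to a single product as long as 2k + 1 stays inside this gap. That is the condition k < (p
-- - 1) / 2.

module Polynomials {c ℓ} (R : CommutativeRing c ℓ) where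

  -- Power series and the action of polynomials on them

  solverRing : AlmostCommutativeRing c ℓ
  solverRing = fromCommutativeRing R (λ _ → nothing)

  -- solve-∀ recognises the ring operations only when they are those of solverRing.
  open CommutativeRing R hiding (_+_; _*_; -_)
  open AlmostCommutativeRing solverRing using (_+_; _*_; -_)
  open CommutativeMonoidMult +-commutativeMonoid using (×-distrib-+)
  open GroupProperties +-group using (⁻¹-involutive; ε⁻¹≈ε)
  open RingProperties ring using (-‿distribˡ-*; -1*x≈-x)
  open SemiringExp semiring using (_^_)
  open SemiringMult semiring using (_×_; ×-congʳ; ×-comm-*)
  open SetoidReasoning setoid

  -- The coefficients of a polynomial or, more generally, of a formal power series.
  Series : Set c
  Series = ℕ → Carrier

  infix 4 _≗_
  _≗_ : Series → Series → Set ℓ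
  F ≗ G = ∀ n → F n ≈ G n

  one : Series
  one zero    = 1#
  one (suc _) = 0#

  -- Multiplication by X.
  shift : Series → Series
  shift F zero    = 0#
  shift F (suc n) = F n

  -- Multiplication by X - r.
  linear : Carrier → Series → Series
  linear r F n = shift F n + - r * F n

  ∂ : Series → Series
  ∂ F n = suc n × F (suc n)

  infixl 7 _·_
  -- The product of a polynomial and a series, by Horner's scheme in the left factor. Lists serve
  -- for what is evaluated or divided, series for what is differentiated and read off at an index;
  -- the mixed product avoids convolution sums.
  _·_ : List Carrier → Series → Series
  ([]      · F) n = 0#
  ((b ∷ f) · F) n = b * F n + shift (f · F) n

  coefficient : List Carrier → Series
  coefficient []      _       = 0#
  coefficient (b ∷ f) zero    = b
  coefficient (b ∷ f) (suc i) = coefficient f i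

  value : List Carrier → Carrier → Carrier
  value []      x = 0#
  value (b ∷ f) x = b + x * value f x

  infixl 6 _⊞_
  _⊞_ : List Carrier → List Carrier → List Carrier
  []      ⊞ g       = g
  (b ∷ f) ⊞ []      = b ∷ f
  (b ∷ f) ⊞ (d ∷ g) = (b + d) ∷ (f ⊞ g)

  -- Synthetic division: the quotient of b ∷ f by X - r, which does not depend on b.
  quotient : Carrier → List Carrier → List Carrier
  quotient r []      = []
  quotient r (b ∷ f) = value (b ∷ f) r ∷ quotient r f

  ×-zero : ∀ n → n × 0# ≈ 0#
  ×-zero zero    = refl
  ×-zero (suc n) = trans (+-identityˡ _) (×-zero n)

  shift-cong : ∀ {F G} → F ≗ G → shift F ≗ shift G
  shift-cong eq zero    = refl
  shift-cong eq (suc n) = eq n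

  shift-0 : ∀ n → shift (λ _ → 0#) n ≈ 0#
  shift-0 zero    = refl
  shift-0 (suc n) = refl

  shift-+ : ∀ F G n → shift (λ i → F i + G i) n ≈ shift F n + shift G n
  shift-+ F G zero    = sym (+-identityˡ 0#)
  shift-+ F G (suc n) = refl

  shift-* : ∀ r F n → shift (λ i → r * F i) n ≈ r * shift F n
  shift-* r F zero    = sym (zeroʳ r)
  shift-* r F (suc n) = refl

  linear-cong : ∀ r {F G} → F ≗ G → linear r F ≗ linear r G
  linear-cong r eq n = +-cong (shift-cong eq n) (*-congˡ (eq n))

  ·-cong : ∀ f {F G} → F ≗ G → f · F ≗ f · G
  ·-cong []      eq n = refl
  ·-cong (b ∷ f) eq n = +-cong (*-congˡ (eq n)) (shift-cong (·-cong f eq) n)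

  ·-0 : ∀ f n → (f · (λ _ → 0#)) n ≈ 0#
  ·-0 []      n = refl
  ·-0 (b ∷ f) n = begin
    b * 0# + shift (f · (λ _ → 0#)) n ≈⟨ +-cong (zeroʳ b) (trans (shift-cong (·-0 f) n) (shift-0 n)) ⟩
    0# + 0#                           ≈⟨ +-identityˡ 0# ⟩
    0#                                ∎

  ·-+ : ∀ f F G n → (f · (λ i → F i + G i)) n ≈ (f · F) n + (f · G) n
  ·-+ []      F G n = sym (+-identityˡ 0#)
  ·-+ (b ∷ f) F G n = begin
    b * (F n + G n) + shift (f · (λ i → F i + G i)) n
      ≈⟨ +-congˡ (trans (shift-cong (·-+ f F G) n) (shift-+ (f · F) (f · G) n)) ⟩
    b * (F n + G n) + (shift (f · F) n + shift (f · G) n)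
      ≈⟨ rearrange b (F n) (G n) (shift (f · F) n) (shift (f · G) n) ⟩
    (b * F n + shift (f · F) n) + (b * G n + shift (f · G) n) ∎
    where
    rearrange : ∀ b x y z w → b * (x + y) + (z + w) ≈ (b * x + z) + (b * y + w)
    rearrange = solve-∀ solverRing

  ·-shift : ∀ f F n → (f · shift F) n ≈ shift (f · F) n
  ·-shift []      F n = sym (shift-0 n)
  ·-shift (b ∷ f) F n = begin
    b * shift F n + shift (f · shift F) n
      ≈⟨ +-cong (sym (shift-* b F n)) (shift-cong (·-shift f F) n) ⟩
    shift (λ i → b * F i) n + shift (shift (f · F)) n
      ≈⟨ shift-+ (λ i → b * F i) (shift (f · F)) n ⟨
    shift ((b ∷ f) · F) n ∎

  ·-* : ∀ f r F n → (f · (λ i → r * F i)) n ≈ r * (f · F) n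
  ·-* []      r F n = sym (zeroʳ r)
  ·-* (b ∷ f) r F n = begin
    b * (r * F n) + shift (f · (λ i → r * F i)) n
      ≈⟨ +-congˡ (trans (shift-cong (·-* f r F) n) (shift-* r (f · F) n)) ⟩
    b * (r * F n) + r * shift (f · F) n
      ≈⟨ rearrange b r (F n) (shift (f · F) n) ⟩
    r * (b * F n + shift (f · F) n) ∎
    where
    rearrange : ∀ b r x y → b * (r * x) + r * y ≈ r * (b * x + y)
    rearrange = solve-∀ solverRing

  ·-linear : ∀ f r F → f · linear r F ≗ linear r (f · F)
  ·-linear f r F n = trans (·-+ f (shift F) (λ i → - r * F i) n) (+-cong (·-shift f F n) (·-* f (- r) F n))

  ∂-shift : ∀ F n → ∂ (shift F) n ≈ shift (∂ F) n + F n
  ∂-shift F zero    = +-comm (F 0) 0#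
  ∂-shift F (suc n) = +-comm (F (suc n)) (∂ F n)

  ∂-linear : ∀ r F n → ∂ (linear r F) n ≈ linear r (∂ F) n + F n
  ∂-linear r F n = begin
    suc n × (F n + - r * F (suc n))
      ≈⟨ ×-distrib-+ (F n) (- r * F (suc n)) (suc n) ⟩
    suc n × F n + suc n × (- r * F (suc n))
      ≈⟨ +-cong (∂-shift F n) (sym (×-comm-* (suc n) (- r) (F (suc n)))) ⟩
    (shift (∂ F) n + F n) + - r * ∂ F n
      ≈⟨ rearrange (shift (∂ F) n) (F n) (- r * ∂ F n) ⟩
    linear r (∂ F) n + F n ∎
    where
    rearrange : ∀ x y z → (x + y) + z ≈ (x + z) + y
    rearrange = solve-∀ solverRing

  ⊞-· : ∀ f g F n → ((f ⊞ g) · F) n ≈ (f · F) n + (g · F) n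
  ⊞-· []      g       F n = sym (+-identityˡ _)
  ⊞-· (b ∷ f) []      F n = sym (+-identityʳ _)
  ⊞-· (b ∷ f) (d ∷ g) F n = begin
    (b + d) * F n + shift ((f ⊞ g) · F) n
      ≈⟨ +-congˡ (trans (shift-cong (⊞-· f g F) n) (shift-+ (f · F) (g · F) n)) ⟩
    (b + d) * F n + (shift (f · F) n + shift (g · F) n)
      ≈⟨ rearrange b d (F n) (shift (f · F) n) (shift (g · F) n) ⟩
    (b * F n + shift (f · F) n) + (d * F n + shift (g · F) n) ∎
    where
    rearrange : ∀ b d x z w → (b + d) * x + (z + w) ≈ (b * x + z) + (d * x + w)
    rearrange = solve-∀ solverRing

  value-⊞ : ∀ f g x → value (f ⊞ g) x ≈ value f x + value g x
  value-⊞ []      g       x = sym (+-identityˡ _)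
  value-⊞ (b ∷ f) []      x = sym (+-identityʳ _)
  value-⊞ (b ∷ f) (d ∷ g) x = begin
    (b + d) + x * value (f ⊞ g) x               ≈⟨ +-congˡ (*-congˡ (value-⊞ f g x)) ⟩
    (b + d) + x * (value f x + value g x)       ≈⟨ rearrange b d x (value f x) (value g x) ⟩
    (b + x * value f x) + (d + x * value g x)   ∎
    where
    rearrange : ∀ b d x z w → (b + d) + x * (z + w) ≈ (b + x * z) + (d + x * w)
    rearrange = solve-∀ solverRing

  length-⊞ : ∀ {m} f g → length f ≤ m → length g ≤ m → length (f ⊞ g) ≤ m
  length-⊞ []      g       f≤ g≤             = g≤
  length-⊞ (b ∷ f) []      f≤ g≤             = f≤
  length-⊞ (b ∷ f) (d ∷ g) (s≤s f≤) (s≤s g≤) = s≤s (length-⊞ f g f≤ g≤)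

  length-quotient : ∀ r f → length (quotient r f) ≡ length f
  length-quotient r []      = ≡.refl
  length-quotient r (b ∷ f) = ≡.cong suc (length-quotient r f)

  -- Synthetic division

  -- This is (x - r) Q(x) = P(x) - P(r) for P = b + X f and its quotient Q, with the subtracted
  -- terms moved across so that the induction meets no negation.
  value-division : ∀ r b f x →
    value (b ∷ f) x + r * value (quotient r f) x ≈ value (b ∷ f) r + x * value (quotient r f) x
  value-division r b []      x = begin
    (b + x * 0#) + r * 0# ≈⟨ +-cong (+-congˡ (zeroʳ x)) refl ⟩
    (b + 0#) + r * 0#     ≈⟨ rearrange b 0# (r * 0#) ⟩
    (b + r * 0#) + 0#     ≈⟨ +-congˡ (zeroʳ x) ⟨
    (b + r * 0#) + x * 0# ∎
    where
    rearrange : ∀ x y z → (x + y) + z ≈ (x + z) + y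
    rearrange = solve-∀ solverRing
  value-division r b (d ∷ f) x = begin
    (b + x * value (d ∷ f) x) + r * (v + x * q)
      ≈⟨ expand b x r (value (d ∷ f) x) v q ⟩
    (b + r * v) + x * (value (d ∷ f) x + r * q)
      ≈⟨ +-congˡ (*-congˡ (value-division r d f x)) ⟩
    (b + r * v) + x * (v + x * q) ∎
    where
    v = value (d ∷ f) r
    q = value (quotient r f) x
    expand : ∀ b x r w v q → (b + x * w) + r * (v + x * q) ≈ (b + r * v) + x * (w + r * q)
    expand = solve-∀ solverRing

  -- The same identity (X - r) Q = P - P(r), multiplied by a series and read coefficientwise.
  ·-division : ∀ r b f F n →
    ((b ∷ f) · F) n + r * (quotient r f · F) n ≈ value (b ∷ f) r * F n + shift (quotient r f · F) n
  ·-division r b []      F n = begin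
    (b * F n + shift (λ _ → 0#) n) + r * 0# ≈⟨ rearrange b r (F n) 0# (shift (λ _ → 0#) n) ⟩
    (b * F n + r * 0#) + shift (λ _ → 0#) n
      ≈⟨ +-congʳ (+-congˡ (trans (zeroʳ r) (sym (trans (*-congʳ (zeroʳ r)) (zeroˡ (F n)))))) ⟩
    (b * F n + (r * 0#) * F n) + shift (λ _ → 0#) n ≈⟨ +-congʳ (distribʳ (F n) b (r * 0#)) ⟨
    (b + r * 0#) * F n + shift (λ _ → 0#) n ∎
    where
    rearrange : ∀ b r x o s → (b * x + s) + r * o ≈ (b * x + r * o) + s
    rearrange = solve-∀ solverRing
  ·-division r b (d ∷ f) F n = begin
    (b * F n + shift ((d ∷ f) · F) n) + r * (v * F n + shift Q n)
      ≈⟨ expand b (F n) (shift ((d ∷ f) · F) n) r v (shift Q n) ⟩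
    (b + r * v) * F n + (shift ((d ∷ f) · F) n + r * shift Q n)
      ≈⟨ +-congˡ shifted ⟩
    (b + r * v) * F n + shift (λ i → v * F i + shift Q i) n ∎
    where
    v = value (d ∷ f) r
    Q = quotient r f · F
    expand : ∀ b x s r v q → (b * x + s) + r * (v * x + q) ≈ (b + r * v) * x + (s + r * q)
    expand = solve-∀ solverRing
    shifted : shift ((d ∷ f) · F) n + r * shift Q n ≈ shift (λ i → v * F i + shift Q i) n
    shifted = begin
      shift ((d ∷ f) · F) n + r * shift Q n           ≈⟨ +-congˡ (shift-* r Q n) ⟨
      shift ((d ∷ f) · F) n + shift (λ i → r * Q i) n ≈⟨ shift-+ ((d ∷ f) · F) (λ i → r * Q i) n ⟨
      shift (λ i → ((d ∷ f) · F) i + r * Q i) n       ≈⟨ shift-cong (·-division r d f F) n ⟩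
      shift (λ i → v * F i + shift Q i) n             ∎

  move : ∀ {x y z} → x + z ≈ y → x ≈ y + - z
  move {x} {y} {z} eq = begin
    x             ≈⟨ +-identityʳ x ⟨
    x + 0#        ≈⟨ +-congˡ (-‿inverseʳ z) ⟨
    x + (z + - z) ≈⟨ +-assoc x z (- z) ⟨
    (x + z) + - z ≈⟨ +-congʳ eq ⟩
    y + - z       ∎

  ·-root : ∀ r b f F → value (b ∷ f) r ≈ 0# → (b ∷ f) · F ≗ linear r (quotient r f · F)
  ·-root r b f F root n = begin
    ((b ∷ f) · F) n                         ≈⟨ move (·-division r b f F n) ⟩
    (value (b ∷ f) r * F n + shift Q n) + - (r * Q n)
      ≈⟨ +-cong (+-congʳ (trans (*-congʳ root) (zeroˡ (F n)))) (-‿distribˡ-* r (Q n)) ⟩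
    (0# + shift Q n) + - r * Q n            ≈⟨ +-congʳ (+-identityˡ (shift Q n)) ⟩
    shift Q n + - r * Q n                   ∎
    where Q = quotient r f · F

  -- Logarithmic derivative of a product of linear factors

  fromRoots : List Carrier → Series
  fromRoots = foldr linear one

  -- If b ∷ f = P, then this is the sum of P / (X - r) over the r in the list.
  quotients : List Carrier → List Carrier → List Carrier
  quotients f = foldr (λ r g → quotient r f ⊞ g) []

  -- Induction with the product rule ((X - r) F)′ = (X - r) F′ + F. In the extra term P F, the root
  -- r of P lets a factor X - r be pulled out, so the new summand P / (X - r) again multiplies (X -
  -- r) F.
  logarithmicDerivative : ∀ b f rs → (∀ r → value (b ∷ f) r ≈ 0#) →
    (b ∷ f) · ∂ (fromRoots rs) ≗ quotients f rs · fromRoots rs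
  logarithmicDerivative b f []       root n = trans (·-cong (b ∷ f) ∂-one n) (·-0 (b ∷ f) n)
    where
    ∂-one : ∂ one ≗ (λ _ → 0#)
    ∂-one i = ×-zero (suc i)
  logarithmicDerivative b f (r ∷ rs) root n = begin
    ((b ∷ f) · ∂ (linear r F)) n
      ≈⟨ ·-cong (b ∷ f) (∂-linear r F) n ⟩
    ((b ∷ f) · (λ i → linear r (∂ F) i + F i)) n
      ≈⟨ ·-+ (b ∷ f) (linear r (∂ F)) F n ⟩
    ((b ∷ f) · linear r (∂ F)) n + ((b ∷ f) · F) n
      ≈⟨ +-cong (·-linear (b ∷ f) r (∂ F) n) (·-root r b f F (root r) n) ⟩
    linear r ((b ∷ f) · ∂ F) n + linear r (quotient r f · F) n
      ≈⟨ +-congʳ (linear-cong r (logarithmicDerivative b f rs root) n) ⟩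
    linear r (quotients f rs · F) n + linear r (quotient r f · F) n
      ≈⟨ +-cong (·-linear (quotients f rs) r F n) (·-linear (quotient r f) r F n) ⟨
    (quotients f rs · linear r F) n + (quotient r f · linear r F) n
      ≈⟨ +-comm _ _ ⟩
    (quotient r f · linear r F) n + (quotients f rs · linear r F) n
      ≈⟨ ⊞-· (quotient r f) (quotients f rs) (linear r F) n ⟨
    ((quotient r f ⊞ quotients f rs) · linear r F) n ∎
    where F = fromRoots rs

  -- Degrees and leading coefficients

  fromRoots-vanishes : ∀ rs n → length rs < n → fromRoots rs n ≈ 0#
  fromRoots-vanishes []       (suc n) _         = refl
  fromRoots-vanishes (r ∷ rs) (suc n) (s≤s l<n) = begin
    fromRoots rs n + - r * fromRoots rs (suc n)
      ≈⟨ +-cong (fromRoots-vanishes rs n l<n) (*-congˡ (fromRoots-vanishes rs (suc n) (ℕ.m<n⇒m<1+n l<n))) ⟩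
    0# + - r * 0# ≈⟨ +-identityˡ _ ⟩
    - r * 0#      ≈⟨ zeroʳ (- r) ⟩
    0#            ∎

  fromRoots-monic : ∀ rs → fromRoots rs (length rs) ≈ 1#
  fromRoots-monic []       = refl
  fromRoots-monic (r ∷ rs) = begin
    fromRoots rs (length rs) + - r * fromRoots rs (suc (length rs))
      ≈⟨ +-cong (fromRoots-monic rs) (*-congˡ (fromRoots-vanishes rs (suc (length rs)) ℕ.≤-refl)) ⟩
    1# + - r * 0# ≈⟨ +-congˡ (zeroʳ (- r)) ⟩
    1# + 0#       ≈⟨ +-identityʳ 1# ⟩
    1#            ∎

  -- At index m + e, a coefficient of f below m meets a coefficient of F inside the gap above e.
  -- This is applied both at the true degree e = p of F and at the false one e = k + 1, which lies
  -- below a gap.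
  ·-top : ∀ f F m e → length f ≤ suc m → (∀ i → e < i → i ≤ m ℕ.+ e → F i ≈ 0#) →
    (f · F) (m ℕ.+ e) ≈ coefficient f m * F e
  ·-top []           F m       e _          _ = sym (zeroˡ (F e))
  ·-top (b ∷ [])     F zero    e _          _ = trans (+-congˡ (shift-0 e)) (+-identityʳ _)
  ·-top (b ∷ d ∷ f)  F zero    e (s≤s ())   _
  ·-top (b ∷ f)      F (suc m) e (s≤s f≤)   F≈0 = begin
    b * F (suc m ℕ.+ e) + (f · F) (m ℕ.+ e)
      ≈⟨ +-cong (*-congˡ (F≈0 (suc m ℕ.+ e) (s≤s (ℕ.m≤n+m e m)) ℕ.≤-refl))
                (·-top f F m e f≤ (λ i e<i i≤ → F≈0 i e<i (ℕ.m≤n⇒m≤1+n i≤))) ⟩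
    b * 0# + coefficient f m * F e ≈⟨ +-congʳ (zeroʳ b) ⟩
    0# + coefficient f m * F e     ≈⟨ +-identityˡ _ ⟩
    coefficient f m * F e          ∎

  ·-zero : ∀ f F → All (_≈ 0#) f → f · F ≗ (λ _ → 0#)
  ·-zero []      F []          n = refl
  ·-zero (b ∷ f) F (b≈0 ∷ f≈0) n = begin
    b * F n + shift (f · F) n
      ≈⟨ +-cong (trans (*-congʳ b≈0) (zeroˡ (F n))) (trans (shift-cong (·-zero f F f≈0) n) (shift-0 n)) ⟩
    0# + 0# ≈⟨ +-identityˡ 0# ⟩
    0#      ∎

  -- Monomials

  monomial : ℕ → List Carrier
  monomial zero    = 1# ∷ []
  monomial (suc q) = 0# ∷ monomial q

  length-monomial : ∀ q → length (monomial q) ≡ suc q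
  length-monomial zero    = ≡.refl
  length-monomial (suc q) = ≡.cong suc (length-monomial q)

  value-monomial : ∀ q x → value (monomial q) x ≈ x ^ q
  value-monomial zero    x = trans (+-congˡ (zeroʳ x)) (+-identityʳ 1#)
  value-monomial (suc q) x = trans (+-identityˡ _) (*-congˡ (value-monomial q x))

  -- The quotient is (X^(q + 1) - x^(q + 1)) / (X - x), whose value at x is the derivative of X^(q +
  -- 1) there.
  value-quotient-monomial : ∀ q x → value (quotient x (monomial q)) x ≈ suc q × x ^ q
  value-quotient-monomial zero    x =
    +-cong (value-monomial 0 x) (zeroʳ x)
  value-quotient-monomial (suc q) x = begin
    value (monomial (suc q)) x + x * value (quotient x (monomial q)) x
      ≈⟨ +-cong (value-monomial (suc q) x) (*-congˡ (value-quotient-monomial q x)) ⟩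
    x ^ suc q + x * (suc q × x ^ q)
      ≈⟨ +-congˡ (×-comm-* (suc q) x (x ^ q)) ⟩
    suc (suc q) × x ^ suc q ∎

  monomial-·-low : ∀ q F n → n < q → (monomial q · F) n ≈ 0#
  monomial-·-low (suc q) F zero    _         = trans (+-identityʳ _) (zeroˡ (F 0))
  monomial-·-low (suc q) F (suc n) (s≤s n<q) =
    trans (+-cong (zeroˡ (F (suc n))) (monomial-·-low q F n n<q)) (+-identityˡ 0#)

  monomial-·-high : ∀ q F m → (monomial q · F) (q ℕ.+ m) ≈ F m
  monomial-·-high zero    F m = trans (+-cong (*-identityˡ (F m)) (shift-0 m)) (+-identityʳ (F m))
  monomial-·-high (suc q) F m = trans (+-cong (zeroˡ _) (monomial-·-high q F m)) (+-identityˡ (F m))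

  value-zero : ∀ f x → All (_≈ 0#) f → value f x ≈ 0#
  value-zero []      x []          = refl
  value-zero (b ∷ f) x (b≈0 ∷ f≈0) =
    trans (+-cong b≈0 (trans (*-congˡ (value-zero f x f≈0)) (zeroʳ x))) (+-identityˡ 0#)

  head-zero : ∀ b f x → value (b ∷ f) x ≈ 0# → All (_≈ 0#) f → b ≈ 0#
  head-zero b f x root f≈0 = begin
    b                   ≈⟨ +-identityʳ b ⟨
    b + 0#              ≈⟨ +-congˡ (trans (*-congˡ (value-zero f x f≈0)) (zeroʳ x)) ⟨
    b + x * value f x   ≈⟨ root ⟩
    0#                  ∎

  -- Roots over an integral domain

  Domain : Set (c ⊔ ℓ)
  Domain = ∀ x y → x * y ≈ 0# → x ≈ 0# ⊎ y ≈ 0#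

  -- When r and x are both roots, `value-division` says that (r - x) Q(x) = 0.
  value-quotient : Domain → ∀ r b f x → value (b ∷ f) r ≈ 0# → value (b ∷ f) x ≈ 0# → r ≉ x →
    value (quotient r f) x ≈ 0#
  value-quotient domain r b f x r-root x-root r≉x with domain (r + - x) q product
    where
    q = value (quotient r f) x
    rq≈xq : r * q ≈ x * q
    rq≈xq = begin
      r * q                   ≈⟨ +-identityˡ _ ⟨
      0# + r * q              ≈⟨ +-congʳ x-root ⟨
      value (b ∷ f) x + r * q ≈⟨ value-division r b f x ⟩
      value (b ∷ f) r + x * q ≈⟨ +-congʳ r-root ⟩
      0# + x * q              ≈⟨ +-identityˡ _ ⟩
      x * q                   ∎
    product : (r + - x) * q ≈ 0#
    product = begin
      (r + - x) * q     ≈⟨ distribʳ q r (- x) ⟩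
      r * q + - x * q   ≈⟨ +-cong rq≈xq (sym (-‿distribˡ-* x q)) ⟩
      x * q + - (x * q) ≈⟨ -‿inverseʳ (x * q) ⟩
      0#                ∎
  ... | inj₁ r-x≈0 = contradiction (begin
    r             ≈⟨ move r-x≈0 ⟩
    0# + - (- x)  ≈⟨ +-identityˡ _ ⟩
    - (- x)       ≈⟨ ⁻¹-involutive x ⟩
    x             ∎) r≉x
  ... | inj₂ q≈0   = q≈0

  -- Dividing by X - x shortens the list by one and keeps the other roots. This turns an equality of
  -- functions into one of polynomials.
  all-roots : Domain →
    ∀ {xs} f → AllPairs _≉_ xs → length f ≤ length xs → All (λ x → value f x ≈ 0#) xs → All (_≈ 0#) f
  all-roots domain []      distinct f≤ roots = []
  all-roots domain {x ∷ xs} (b ∷ f) (x≉xs ∷ distinct) (s≤s f≤) (x-root ∷ roots) = b≈0 ∷ f≈0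
    where
    quotient-roots : ∀ {ys} → All (x ≉_) ys →
      All (λ y → value (b ∷ f) y ≈ 0#) ys → All (λ y → value (quotient x f) y ≈ 0#) ys
    quotient-roots []           []             = []
    quotient-roots (x≉y ∷ x≉ys) (y-root ∷ rest) =
      value-quotient domain x b f _ x-root y-root x≉y ∷ quotient-roots x≉ys rest
    -- The entries of the quotient are the values at x of the successive tails of g, so they
    -- determine the coefficients of g from the last one back.
    unquotient : ∀ g → All (_≈ 0#) (quotient x g) → All (_≈ 0#) g
    unquotient []      []          = []
    unquotient (d ∷ g) (v≈0 ∷ q≈0) = head-zero d g x v≈0 (unquotient g q≈0) ∷ unquotient g q≈0
    f≈0 : All (_≈ 0#) f
    f≈0 = unquotient f (all-roots domain (quotient x f) distinct
      (≡.subst (_≤ length xs) (≡.sym (length-quotient x f)) f≤) (quotient-roots x≉xs roots))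
    b≈0 = head-zero b f x x-root f≈0

  -- Sums of quotients over roots with multiplicity

  value-quotients-++ : ∀ f rs ss x →
    value (quotients f (rs ++ ss)) x ≈ value (quotients f rs) x + value (quotients f ss) x
  value-quotients-++ f []       ss x = sym (+-identityˡ _)
  value-quotients-++ f (r ∷ rs) ss x = begin
    value (quotient r f ⊞ quotients f (rs ++ ss)) x
      ≈⟨ value-⊞ (quotient r f) (quotients f (rs ++ ss)) x ⟩
    value (quotient r f) x + value (quotients f (rs ++ ss)) x
      ≈⟨ +-congˡ (value-quotients-++ f rs ss x) ⟩
    value (quotient r f) x + (value (quotients f rs) x + value (quotients f ss) x)
      ≈⟨ +-assoc _ _ _ ⟨
    (value (quotient r f) x + value (quotients f rs) x) + value (quotients f ss) x
      ≈⟨ +-congʳ (value-⊞ (quotient r f) (quotients f rs) x) ⟨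
    value (quotient r f ⊞ quotients f rs) x + value (quotients f ss) x ∎

  value-quotients-replicate : ∀ f n r x → value (quotients f (replicate n r)) x ≈ n × value (quotient r f) x
  value-quotients-replicate f zero    r x = refl
  value-quotients-replicate f (suc n) r x =
    trans (value-⊞ (quotient r f) (quotients f (replicate n r)) x) (+-congˡ (value-quotients-replicate f n r x))

  length-quotients : ∀ f rs → length (quotients f rs) ≤ length f
  length-quotients f []       = z≤n
  length-quotients f (r ∷ rs) =
    length-⊞ (quotient r f) (quotients f rs) (ℕ.≤-reflexive (length-quotient r f)) (length-quotients f rs)

  module _ (m : Carrier → ℕ) where

    withMultiplicity : List Carrier → List Carrier
    withMultiplicity = concatMap (λ r → replicate (m r) r)

    length-withMultiplicity : ∀ rs → length (withMultiplicity rs) ≡ sum (map m rs)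
    length-withMultiplicity []       = ≡.refl
    length-withMultiplicity (r ∷ rs) = ≡.trans (length-++ (replicate (m r) r))
      (≡.cong₂ ℕ._+_ (length-replicate (m r)) (length-withMultiplicity rs))

    module _ (f : List Carrier) (x : Carrier) where

      value-quotients-∷ : ∀ r rs → value (quotients f (withMultiplicity (r ∷ rs))) x ≈
        m r × value (quotient r f) x + value (quotients f (withMultiplicity rs)) x
      value-quotients-∷ r rs = trans (value-quotients-++ f (replicate (m r) r) (withMultiplicity rs) x)
        (+-congʳ (value-quotients-replicate f (m r) r x))

      value-quotients-∉ : ∀ {rs} → All (λ r → value (quotient r f) x ≈ 0#) rs →
        value (quotients f (withMultiplicity rs)) x ≈ 0#
      value-quotients-∉ {[]}     []       = refl
      value-quotients-∉ {r ∷ rs} (v ∷ vs) = begin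
        value (quotients f (withMultiplicity (r ∷ rs))) x ≈⟨ value-quotients-∷ r rs ⟩
        m r × value (quotient r f) x + value (quotients f (withMultiplicity rs)) x
          ≈⟨ +-cong (trans (×-congʳ (m r) v) (×-zero (m r))) (value-quotients-∉ vs) ⟩
        0# + 0#                                           ≈⟨ +-identityˡ 0# ⟩
        0#                                                ∎

      -- As `rs` has no repetitions, x contributes exactly one block of `m x` equal summands, and
      -- every other block vanishes at x.
      value-quotients-∈ : (∀ r → r ≢ x → value (quotient r f) x ≈ 0#) →
        ∀ {rs} → Unique rs → x ∈ rs →
        value (quotients f (withMultiplicity rs)) x ≈ m x × value (quotient x f) x
      value-quotients-∈ off {r ∷ rs} (x≢rs ∷ _) (here ≡.refl) = begin
        value (quotients f (withMultiplicity (r ∷ rs))) x ≈⟨ value-quotients-∷ r rs ⟩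
        m r × value (quotient r f) x + value (quotients f (withMultiplicity rs)) x
          ≈⟨ +-congˡ (value-quotients-∉ (All.map (λ x≢r → off _ (≡.≢-sym x≢r)) x≢rs)) ⟩
        m r × value (quotient r f) x + 0#                 ≈⟨ +-identityʳ _ ⟩
        m r × value (quotient r f) x                      ∎
      value-quotients-∈ off {r ∷ rs} (r≢rs ∷ unique) (there x∈rs) = begin
        value (quotients f (withMultiplicity (r ∷ rs))) x ≈⟨ value-quotients-∷ r rs ⟩
        m r × value (quotient r f) x + value (quotients f (withMultiplicity rs)) x
          ≈⟨ +-cong (trans (×-congʳ (m r) (off r (All.lookup r≢rs x∈rs))) (×-zero (m r)))
                    (value-quotients-∈ off unique x∈rs) ⟩
        0# + m x × value (quotient x f) x                 ≈⟨ +-identityˡ _ ⟩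
        m x × value (quotient x f) x                      ∎

  coefficient-vanishes : ∀ f m → length f ≤ m → coefficient f m ≈ 0#
  coefficient-vanishes []      m       _        = refl
  coefficient-vanishes (b ∷ f) (suc m) (s≤s f≤) = coefficient-vanishes f m f≤

  -- The polynomial P = X^p - X and the comparison of coefficients

  module _ (q : ℕ) where

    private
      p : ℕ
      p = suc (suc q)

    -- Taking p as q + 2 lets the coefficients of 1 and X be written out, with `monomial q`
    -- supplying the leading term.
    X^p-X : List Carrier
    X^p-X = 0# ∷ - 1# ∷ monomial q

    X^p-X-·-high : ∀ F m → (X^p-X · F) (p ℕ.+ m) ≈ F m + - F (suc (q ℕ.+ m))
    X^p-X-·-high F m = begin
      0# * F (p ℕ.+ m) + (- 1# * F (suc (q ℕ.+ m)) + (monomial q · F) (q ℕ.+ m))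
        ≈⟨ +-cong (zeroˡ _) (+-cong (-1*x≈-x _) (monomial-·-high q F m)) ⟩
      0# + (- F (suc (q ℕ.+ m)) + F m) ≈⟨ +-identityˡ _ ⟩
      - F (suc (q ℕ.+ m)) + F m        ≈⟨ +-comm _ _ ⟩
      F m + - F (suc (q ℕ.+ m))        ∎

    X^p-X-·-low : ∀ F n → suc n < p → (X^p-X · F) (suc n) ≈ - F n
    X^p-X-·-low F n (s≤s (s≤s n≤q)) = begin
      0# * F (suc n) + (- 1# * F n + shift (monomial q · F) n)
        ≈⟨ +-cong (zeroˡ _) (+-cong (-1*x≈-x _) (vanishing n n≤q)) ⟩
      0# + (- F n + 0#) ≈⟨ trans (+-identityˡ _) (+-identityʳ _) ⟩
      - F n             ∎
      where
      vanishing : ∀ i → i ≤ q → shift (monomial q · F) i ≈ 0#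
      vanishing zero    _   = refl
      vanishing (suc i) i<q = monomial-·-low q F i i<q

    value-X^p-X : ∀ x → x ^ p ≈ x → value X^p-X x ≈ 0#
    value-X^p-X x fermat = begin
      0# + x * (- 1# + x * value (monomial q) x) ≈⟨ +-identityˡ _ ⟩
      x * (- 1# + x * value (monomial q) x)      ≈⟨ distribˡ x (- 1#) _ ⟩
      x * - 1# + x * (x * value (monomial q) x)
        ≈⟨ +-cong (trans (*-comm x (- 1#)) (-1*x≈-x x)) (*-congˡ (*-congˡ (value-monomial q x))) ⟩
      - x + x ^ p                                ≈⟨ +-congˡ fermat ⟩
      - x + x                                    ≈⟨ -‿inverseˡ x ⟩
      0#                                         ∎

    -- P / (X - x) takes at x the value P′(x) = p x^(p - 1) - 1, and multiples of p vanish.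
    value-quotient-X^p-X : (∀ x → p × x ≈ 0#) → ∀ x → value (quotient x (- 1# ∷ monomial q)) x ≈ - 1#
    value-quotient-X^p-X char x = begin
      (- 1# + x * value (monomial q) x) + x * value (quotient x (monomial q)) x
        ≈⟨ +-cong (+-congˡ (*-congˡ (value-monomial q x)))
                  (trans (*-congˡ (value-quotient-monomial q x)) (×-comm-* (suc q) x (x ^ q))) ⟩
      (- 1# + x ^ suc q) + suc q × x ^ suc q ≈⟨ +-assoc _ _ _ ⟩
      - 1# + p × x ^ suc q                   ≈⟨ +-congˡ (char _) ⟩
      - 1# + 0#                              ≈⟨ +-identityʳ _ ⟩
      - 1#                                   ∎

    module _ (domain : Domain)
             (torsion-free : ∀ n x → 0 < n → n < p → n × x ≈ 0# → x ≈ 0#)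
             (F : Series) (F-monic : F p ≈ 1#) (F-degree : ∀ n → p < n → F n ≈ 0#)
             (f : List Carrier) (equation : ∀ n → (X^p-X · ∂ F) n ≈ - (f · F) n)
      where

      ∂-tail : ∀ m → 0 < m → length f ≤ suc m → ∂ F m ≈ - coefficient f m
      ∂-tail m 0<m f≤ = begin
        ∂ F m                               ≈⟨ +-identityʳ _ ⟨
        ∂ F m + 0#                          ≈⟨ +-congˡ ε⁻¹≈ε ⟨
        ∂ F m + - 0#                        ≈⟨ +-congˡ (-‿cong beyond-degree) ⟨
        ∂ F m + - ∂ F (suc (q ℕ.+ m))       ≈⟨ X^p-X-·-high (∂ F) m ⟨
        (X^p-X · ∂ F) (p ℕ.+ m)             ≈⟨ equation (p ℕ.+ m) ⟩
        - (f · F) (p ℕ.+ m)                 ≡⟨ ≡.cong (λ i → - (f · F) i) (ℕ.+-comm p m) ⟩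
        - (f · F) (m ℕ.+ p)                 ≈⟨ -‿cong (·-top f F m p f≤ (λ i p<i _ → F-degree i p<i)) ⟩
        - (coefficient f m * F p)           ≈⟨ -‿cong (trans (*-congˡ F-monic) (*-identityʳ _)) ⟩
        - coefficient f m                   ∎
        where
        -- This coefficient of F′ is a multiple of the coefficient of F at p + m, which exceeds the
        -- degree p because m > 0.
        beyond-degree : ∂ F (suc (q ℕ.+ m)) ≈ 0#
        beyond-degree = trans (×-congʳ (p ℕ.+ m) (F-degree (p ℕ.+ m) (ℕ.m<m+n p 0<m))) (×-zero (p ℕ.+ m))

      ∂-vanishes : ∀ m → 0 < m → length f ≤ m → ∂ F m ≈ 0#
      ∂-vanishes m 0<m f≤ = begin
        ∂ F m             ≈⟨ ∂-tail m 0<m (ℕ.m≤n⇒m≤1+n f≤) ⟩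
        - coefficient f m ≈⟨ -‿cong (coefficient-vanishes f m f≤) ⟩
        - 0#              ≈⟨ ε⁻¹≈ε ⟩
        0#                ∎

      top-coefficient-vanishes : ∀ k → 0 < k → length f ≤ suc k → suc (k ℕ.+ k) < p → coefficient f k ≈ 0#
      top-coefficient-vanishes k 0<k f≤ 2k+1<p with domain (coefficient f k) (F (suc k)) product
        where
        -- Here i times the coefficient of F at i is a vanishing coefficient of F′, and 0 < i < p
        -- allows i to be cancelled.
        gap : ∀ i → suc k < i → i ≤ k ℕ.+ suc k → F i ≈ 0#
        gap (suc i) (s≤s k<i) i≤ = torsion-free (suc i) (F (suc i)) (s≤s z≤n)
          (ℕ.≤-<-trans (≡.subst (suc i ≤_) (ℕ.+-suc k k) i≤) 2k+1<p)
          (∂-vanishes i (ℕ.<-trans 0<k k<i) (ℕ.≤-trans f≤ k<i))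
        product : coefficient f k * F (suc k) ≈ 0#
        product = begin
          coefficient f k * F (suc k)       ≈⟨ ·-top f F k (suc k) f≤ gap ⟨
          (f · F) (k ℕ.+ suc k)             ≡⟨ ≡.cong (f · F) (ℕ.+-suc k k) ⟩
          (f · F) (suc (k ℕ.+ k))           ≈⟨ ⁻¹-involutive _ ⟨
          - - (f · F) (suc (k ℕ.+ k))       ≈⟨ -‿cong (equation (suc (k ℕ.+ k))) ⟨
          - (X^p-X · ∂ F) (suc (k ℕ.+ k))   ≈⟨ -‿cong (X^p-X-·-low (∂ F) (k ℕ.+ k) 2k+1<p) ⟩
          - - ∂ F (k ℕ.+ k)                 ≈⟨ ⁻¹-involutive _ ⟩
          -- As k > 0, the index 2k is at least k + 1, where F′ already vanishes.
          ∂ F (k ℕ.+ k)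
            ≈⟨ ∂-vanishes (k ℕ.+ k) (ℕ.<-≤-trans 0<k (ℕ.m≤m+n k k)) (ℕ.≤-trans f≤ (ℕ.+-monoˡ-≤ k 0<k)) ⟩
          0#                                ∎
      ... | inj₁ top≈0 = top≈0
      ... | inj₂ F≈0   = begin
        coefficient f k       ≈⟨ ⁻¹-involutive _ ⟨
        - - coefficient f k   ≈⟨ -‿cong (∂-tail k 0<k f≤) ⟨
        - ∂ F k               ≈⟨ -‿cong (trans (×-congʳ (suc k) F≈0) (×-zero (suc k))) ⟩
        - 0#                  ≈⟨ ε⁻¹≈ε ⟩
        0#                    ∎

-- Divisibility of binomial coefficients by a prime

-- Pascal's rule splits the left side, the induction hypothesis handles both pieces, and Pascal's
-- rule one row lower reassembles them.
absorption : ∀ n k → suc k ℕ.* (suc n C suc k) ≡ suc n ℕ.* (n C k)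
absorption zero    zero    = ≡.refl
absorption zero    (suc k) = ≡.trans
  (≡.cong (suc (suc k) ℕ.*_) (k>n⇒nCk≡0 {1} {suc (suc k)} (s≤s (s≤s z≤n)))) (ℕ.*-zeroʳ (suc (suc k)))
absorption (suc n) zero    =
  ≡.trans (ℕ.*-identityˡ _) (≡.trans (nC1≡n (suc (suc n))) (≡.sym (ℕ.*-identityʳ _)))
absorption (suc n) (suc k) = begin
  suc (suc k) ℕ.* (suc (suc n) C suc (suc k))
    ≡⟨ ≡.cong (suc (suc k) ℕ.*_) (nCk+nC[k+1]≡[n+1]C[k+1] (suc n) (suc k)) ⟨
  suc (suc k) ℕ.* (c ℕ.+ d)                          ≡⟨ ℕ.*-distribˡ-+ (suc (suc k)) c d ⟩
  (c ℕ.+ suc k ℕ.* c) ℕ.+ suc (suc k) ℕ.* d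
    ≡⟨ ≡.cong₂ (λ u v → (c ℕ.+ u) ℕ.+ v) (absorption n k) (absorption n (suc k)) ⟩
  (c ℕ.+ suc n ℕ.* (n C k)) ℕ.+ suc n ℕ.* (n C suc k) ≡⟨ ℕ.+-assoc c _ _ ⟩
  c ℕ.+ (suc n ℕ.* (n C k) ℕ.+ suc n ℕ.* (n C suc k))
    ≡⟨ ≡.cong (c ℕ.+_) (ℕ.*-distribˡ-+ (suc n) (n C k) (n C suc k)) ⟨
  c ℕ.+ suc n ℕ.* (n C k ℕ.+ n C suc k)
    ≡⟨ ≡.cong (λ u → c ℕ.+ suc n ℕ.* u) (nCk+nC[k+1]≡[n+1]C[k+1] n k) ⟩
  suc (suc n) ℕ.* c                                  ∎
  where
  open ≡.≡-Reasoning
  c = suc n C suc k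
  d = suc n C suc (suc k)

-- By `absorption`, p divides k times the binomial coefficient; it cannot divide k, which is
-- smaller.
prime∣binomial : ∀ {p} → Prime p → ∀ k → 0 < k → k < p → p ∣ p C k
prime∣binomial {suc n} p-prime (suc k) _ k<p
  with euclidsLemma (suc k) (suc n C suc k) p-prime
         (divides (n C k) (≡.trans (absorption n k) (ℕ.*-comm (suc n) (n C k))))
... | inj₁ p∣k = contradiction p∣k (>⇒∤ k<p)
... | inj₂ p∣C = p∣C

-- Frobenius and Fermat in prime characteristic

module Characteristic {c ℓ} (R : CommutativeRing c ℓ) where

  open CommutativeRing R hiding (zero)
  open CommutativeSemiringBinomial commutativeSemiring using (binomialTerm; theorem)
  open MonoidSum +-monoid using (sum-init-last; sum-cong-≋; sum-replicate-zero) renaming (sum to ∑)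
  open SemiringExp semiring using (_^_)
  open SemiringMult semiring using (_×_; ×-congˡ; ×-assocˡ)
  open SetoidReasoning setoid

  1^ : ∀ n → 1# ^ n ≈ 1#
  1^ zero    = refl
  1^ (suc n) = trans (*-identityˡ _) (1^ n)

  module _ {p : ℕ} (p-prime : Prime p) (char : ∀ x → p × x ≈ 0#) where

    ∣⇒×≈0 : ∀ {n} x → p ∣ n → n × x ≈ 0#
    ∣⇒×≈0 {n} x (divides k n≡kp) = begin
      n × x           ≈⟨ ×-congˡ (≡.trans n≡kp (ℕ.*-comm k p)) ⟩
      (p ℕ.* k) × x   ≈⟨ ×-assocˡ x p k ⟨
      p × (k × x)     ≈⟨ char (k × x) ⟩
      0#              ∎

    frobenius : ∀ x y → (x + y) ^ p ≈ x ^ p + y ^ p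
    frobenius x y = expand p ≡.refl
      where
      -- Splitting a copy n of the fixed p exposes its successor form, in which the two outer
      -- binomial terms can be detached; p divides the coefficients of the others.
      expand : ∀ n → n ≡ p → (x + y) ^ n ≈ x ^ n + y ^ n
      expand zero    ≡.refl = contradiction p-prime ¬prime[0]
      expand (suc n) ≡.refl = begin
        (x + y) ^ suc n                             ≈⟨ theorem (suc n) x y ⟩
        term zero + ∑ (λ i → term (suc i))          ≈⟨ +-congˡ (sum-init-last (λ i → term (suc i))) ⟩
        term zero + (∑ (λ i → term (suc (inject₁ i))) + term (suc (fromℕ n)))
          ≈⟨ +-cong first (+-cong middle last) ⟩
        y ^ suc n + (0# + x ^ suc n)                ≈⟨ +-congˡ (+-identityˡ _) ⟩
        y ^ suc n + x ^ suc n                       ≈⟨ +-comm _ _ ⟩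
        x ^ suc n + y ^ suc n                       ∎
        where
        term : Fin (suc (suc n)) → Carrier
        term = binomialTerm x y (suc n)
        first : term zero ≈ y ^ suc n
        first = trans (+-identityʳ _) (*-identityˡ _)
        last : term (suc (fromℕ n)) ≈ x ^ suc n
        last = begin
          (suc n C suc (toℕ (fromℕ n))) × (x ^ suc (toℕ (fromℕ n)) * y ^ (n ∸ toℕ (fromℕ n)))
            ≡⟨ ≡.cong (λ k → (suc n C suc k) × (x ^ suc k * y ^ (n ∸ k))) (toℕ-fromℕ n) ⟩
          (suc n C suc n) × (x ^ suc n * y ^ (n ∸ n))
            ≡⟨ ≡.cong₂ (λ i j → i × (x ^ suc n * y ^ j)) (nCn≡1 (suc n)) (ℕ.n∸n≡0 n) ⟩
          1 × (x ^ suc n * 1#)      ≈⟨ trans (+-identityʳ _) (*-identityʳ _) ⟩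
          x ^ suc n                 ∎
        middle : ∑ (λ i → term (suc (inject₁ i))) ≈ 0#
        middle = trans (sum-cong-≋ (λ i → ∣⇒×≈0 _
          (prime∣binomial p-prime (suc (toℕ (inject₁ i))) (s≤s z≤n)
          (s≤s (≡.subst (_< n) (≡.sym (toℕ-inject₁ i)) (toℕ<n i)))))) (sum-replicate-zero n)

    -- Adding 1 commutes with the p-th power by `frobenius`, so induction on n works. In 𝔽 p the
    -- multiples of 1 are all the elements.
    fermat : ∀ n → (n × 1#) ^ p ≈ n × 1#
    fermat zero    = zero^ p ≡.refl
      where
      zero^ : ∀ n → n ≡ p → 0# ^ n ≈ 0#
      zero^ zero    ≡.refl = contradiction p-prime ¬prime[0]
      zero^ (suc n) _      = zeroˡ _
    fermat (suc n) = begin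
      (1# + n × 1#) ^ p       ≈⟨ frobenius 1# (n × 1#) ⟩
      1# ^ p + (n × 1#) ^ p   ≈⟨ +-cong (1^ p) (fermat n) ⟩
      1# + n × 1#             ∎

-- The ring of integers modulo p

module ResidueRing (p : ℕ) .{{_ : NonZero p}} where

  1ₚ : 𝔽 p
  1ₚ = 1 mod p

  -- At x = 0 the difference is p itself, which the final reduction sends to 0.
  -ₚ_ : 𝔽 p → 𝔽 p
  -ₚ x = (p ∸ toℕ x) mod p

  toℕ-mod : ∀ m → toℕ (m mod p) ≡ m % p
  toℕ-mod m = toℕ-fromℕ< (m%n<n m p)

  mod-cong : ∀ {m n} → m % p ≡ n % p → m mod p ≡ n mod p
  mod-cong {m} {n} eq = toℕ-injective (≡.trans (toℕ-mod m) (≡.trans eq (≡.sym (toℕ-mod n))))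

  mod-toℕ : ∀ x → toℕ x mod p ≡ x
  mod-toℕ x = toℕ-injective (≡.trans (toℕ-mod (toℕ x)) (m<n⇒m%n≡m (toℕ<n x)))

  mod-+ : ∀ m n → (m mod p) +ₚ (n mod p) ≡ (m ℕ.+ n) mod p
  mod-+ m n = ≡.trans (≡.cong₂ (λ a b → (a ℕ.+ b) mod p) (toℕ-mod m) (toℕ-mod n))
    (mod-cong (≡.sym (%-distribˡ-+ m n p)))

  mod-* : ∀ m n → (m mod p) *ₚ (n mod p) ≡ (m ℕ.* n) mod p
  mod-* m n = ≡.trans (≡.cong₂ (λ a b → (a ℕ.* b) mod p) (toℕ-mod m) (toℕ-mod n))
    (mod-cong (≡.sym (%-distribˡ-* m n p)))

  -- This and its companions absorb an inner reduction into the outer one, so that each ring law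
  -- follows from the law in ℕ under a single `mod`.
  mod-+ˡ : ∀ m y → (m mod p) +ₚ y ≡ (m ℕ.+ toℕ y) mod p
  mod-+ˡ m y = ≡.trans (≡.cong ((m mod p) +ₚ_) (≡.sym (mod-toℕ y))) (mod-+ m (toℕ y))

  mod-+ʳ : ∀ x n → x +ₚ (n mod p) ≡ (toℕ x ℕ.+ n) mod p
  mod-+ʳ x n = ≡.trans (≡.cong (_+ₚ (n mod p)) (≡.sym (mod-toℕ x))) (mod-+ (toℕ x) n)

  mod-*ˡ : ∀ m y → (m mod p) *ₚ y ≡ (m ℕ.* toℕ y) mod p
  mod-*ˡ m y = ≡.trans (≡.cong ((m mod p) *ₚ_) (≡.sym (mod-toℕ y))) (mod-* m (toℕ y))

  mod-*ʳ : ∀ x n → x *ₚ (n mod p) ≡ (toℕ x ℕ.* n) mod p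
  mod-*ʳ x n = ≡.trans (≡.cong (_*ₚ (n mod p)) (≡.sym (mod-toℕ x))) (mod-* (toℕ x) n)

  ∣⇒mod≡0 : ∀ {m} → p ∣ m → m mod p ≡ 0ₚ
  ∣⇒mod≡0 {m} p∣m = mod-cong (≡.trans (n∣m⇒m%n≡0 m p p∣m) (≡.sym (n∣m⇒m%n≡0 0 p (p ∣0))))

  mod≡0⇒∣ : ∀ {m} → m mod p ≡ 0ₚ → p ∣ m
  mod≡0⇒∣ {m} eq = m%n≡0⇒n∣m m p (≡.trans (≡.sym (toℕ-mod m))
    (≡.trans (≡.cong toℕ eq) (≡.trans (toℕ-mod 0) (n∣m⇒m%n≡0 0 p (p ∣0)))))

  +ₚ-comm : ∀ x y → x +ₚ y ≡ y +ₚ x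
  +ₚ-comm x y = ≡.cong (_mod p) (ℕ.+-comm (toℕ x) (toℕ y))

  *ₚ-comm : ∀ x y → x *ₚ y ≡ y *ₚ x
  *ₚ-comm x y = ≡.cong (_mod p) (ℕ.*-comm (toℕ x) (toℕ y))

  +ₚ-assoc : ∀ x y z → (x +ₚ y) +ₚ z ≡ x +ₚ (y +ₚ z)
  +ₚ-assoc x y z = ≡.trans (mod-+ˡ _ z)
    (≡.trans (≡.cong (_mod p) (ℕ.+-assoc (toℕ x) (toℕ y) (toℕ z))) (≡.sym (mod-+ʳ x _)))

  *ₚ-assoc : ∀ x y z → (x *ₚ y) *ₚ z ≡ x *ₚ (y *ₚ z)
  *ₚ-assoc x y z = ≡.trans (mod-*ˡ _ z)
    (≡.trans (≡.cong (_mod p) (ℕ.*-assoc (toℕ x) (toℕ y) (toℕ z))) (≡.sym (mod-*ʳ x _)))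

  +ₚ-identityˡ : ∀ x → 0ₚ +ₚ x ≡ x
  +ₚ-identityˡ x = ≡.trans (mod-+ˡ 0 x) (mod-toℕ x)

  *ₚ-identityˡ : ∀ x → 1ₚ *ₚ x ≡ x
  *ₚ-identityˡ x = ≡.trans (mod-*ˡ 1 x) (≡.trans (≡.cong (_mod p) (ℕ.*-identityˡ (toℕ x))) (mod-toℕ x))

  -ₚ-inverseʳ : ∀ x → x +ₚ (-ₚ x) ≡ 0ₚ
  -ₚ-inverseʳ x = ≡.trans (mod-+ʳ x _)
    (≡.trans (≡.cong (_mod p) (ℕ.m+[n∸m]≡n (ℕ.<⇒≤ (toℕ<n x)))) (∣⇒mod≡0 ∣-refl))

  *ₚ-distribˡ-+ₚ : ∀ x y z → x *ₚ (y +ₚ z) ≡ (x *ₚ y) +ₚ (x *ₚ z)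
  *ₚ-distribˡ-+ₚ x y z = ≡.trans (mod-*ʳ x _)
    (≡.trans (≡.cong (_mod p) (ℕ.*-distribˡ-+ (toℕ x) (toℕ y) (toℕ z))) (≡.sym (mod-+ _ _)))

  commutativeRing : CommutativeRing 0ℓ 0ℓ
  commutativeRing = record
    { Carrier = 𝔽 p
    ; _≈_ = _≡_
    ; _+_ = _+ₚ_
    ; _*_ = _*ₚ_
    ; -_ = -ₚ_
    ; 0# = 0ₚ
    ; 1# = 1ₚ
    ; isCommutativeRing = record
      { isRing = record
        { +-isAbelianGroup = record
          { isGroup = record
            { isMonoid = record
              { isSemigroup = record
                { isMagma = record { isEquivalence = ≡.isEquivalence ; ∙-cong = ≡.cong₂ _+ₚ_ }
                ; assoc = +ₚ-assoc
                }
              ; identity = comm∧idˡ⇒id +ₚ-comm +ₚ-identityˡ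
              }
            ; inverse = comm∧invʳ⇒inv +ₚ-comm -ₚ-inverseʳ
            ; ⁻¹-cong = ≡.cong -ₚ_
            }
          ; comm = +ₚ-comm
          }
        ; *-cong = ≡.cong₂ _*ₚ_
        ; *-assoc = *ₚ-assoc
        ; *-identity = comm∧idˡ⇒id *ₚ-comm *ₚ-identityˡ
        ; distrib = *ₚ-distribˡ-+ₚ , comm∧distrˡ⇒distrʳ *ₚ-comm *ₚ-distribˡ-+ₚ
        }
      ; *-comm = *ₚ-comm
      }
    }

  open SemiringMult (CommutativeRing.semiring commutativeRing) using (_×_)

  ×-mod : ∀ n x → n × x ≡ (n ℕ.* toℕ x) mod p
  ×-mod zero    x = ≡.refl
  ×-mod (suc n) x = ≡.trans (≡.cong (x +ₚ_) (×-mod n x)) (mod-+ʳ x _)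

  p×x≡0 : ∀ x → p × x ≡ 0ₚ
  p×x≡0 x = ≡.trans (×-mod p x) (∣⇒mod≡0 (m∣m*n (toℕ x)))

  toℕ-×-1 : ∀ x → toℕ x × 1ₚ ≡ x
  toℕ-×-1 x = ≡.trans (×-mod (toℕ x) 1ₚ) (≡.trans (≡.sym (mod-*ʳ x (toℕ 1ₚ)))
    (≡.trans (≡.cong (x *ₚ_) (mod-toℕ 1ₚ)) (≡.trans (*ₚ-comm x 1ₚ) (*ₚ-identityˡ x))))

  module _ (p-prime : Prime p) where

    -- Keeping m a natural number makes this serve both products of residues and natural multiples
    -- of a residue.
    ∣-product : ∀ m x → p ∣ m ℕ.* toℕ x → p ∣ m ⊎ x ≡ 0ₚ
    ∣-product m x p∣mx = Sum.map₂ (λ p∣x → ≡.trans (≡.sym (mod-toℕ x)) (∣⇒mod≡0 p∣x))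
      (euclidsLemma m (toℕ x) p-prime p∣mx)

    no-zero-divisors : ∀ x y → x *ₚ y ≡ 0ₚ → x ≡ 0ₚ ⊎ y ≡ 0ₚ
    no-zero-divisors x y xy≡0 = Sum.map₁ (λ p∣x → ≡.trans (≡.sym (mod-toℕ x)) (∣⇒mod≡0 p∣x))
      (∣-product (toℕ x) y (mod≡0⇒∣ xy≡0))

    ×-torsion-free : ∀ n x → 0 < n → n < p → n × x ≡ 0ₚ → x ≡ 0ₚ
    ×-torsion-free (suc n) x _ n<p nx≡0
      with ∣-product (suc n) x (mod≡0⇒∣ (≡.trans (≡.sym (×-mod (suc n) x)) nx≡0))
    ... | inj₁ p∣n = contradiction p∣n (>⇒∤ n<p)
    ... | inj₂ x≡0 = x≡0

-- Degree and the removal of trailing zeros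

module _ {p : ℕ} .{{_ : NonZero p}} where

  -- The coefficient arguments bound lengths of lists, while the theorem speaks of `deg`. The same
  -- test as in `deg` is used, so one case split reduces both.
  trim : 𝔽[X] p → 𝔽[X] p
  trim []      = []
  trim (a ∷ f) with all? (_≟ 0ₚ) f
  ... | yes _ = a ∷ []
  ... | no  _ = a ∷ trim f

  length-trim : ∀ f → length (trim f) ≤ suc (deg f)
  length-trim []      = z≤n
  length-trim (a ∷ f) with all? (_≟ 0ₚ) f
  ... | yes _ = s≤s z≤n
  ... | no  _ = s≤s (length-trim f)

  eval-zero : ∀ f x → All (_≡ 0ₚ) f → eval f x ≡ 0ₚ
  eval-zero []      x []          = ≡.refl
  eval-zero (a ∷ f) x (a≡0 ∷ f≡0) = ≡.trans (≡.cong₂ (λ u v → u +ₚ x *ₚ v) a≡0 (eval-zero f x f≡0))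
    (≡.trans (ResidueRing.+ₚ-identityˡ p _) (CommutativeRing.zeroʳ (ResidueRing.commutativeRing p) x))

  eval-trim : ∀ f x → eval (trim f) x ≡ eval f x
  eval-trim []      x = ≡.refl
  eval-trim (a ∷ f) x with all? (_≟ 0ₚ) f
  ... | yes f≡0 = ≡.cong (λ v → a +ₚ x *ₚ v) (≡.sym (eval-zero f x f≡0))
  ... | no  _   = ≡.cong (λ v → a +ₚ x *ₚ v) (eval-trim f x)

  -- The zero polynomial has to be excluded, since its conventional degree 0 points at a zero
  -- coefficient.
  trim-leading : ∀ f → ¬ All (_≡ 0ₚ) f → coeff (trim f) (deg f) ≢ 0ₚ
  trim-leading []      f≢0 = contradiction [] f≢0
  trim-leading (a ∷ f) f≢0 with all? (_≟ 0ₚ) f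
  ... | yes f≡0 = λ a≡0 → f≢0 (a≡0 ∷ f≡0)
  ... | no  f≢0 = trim-leading f f≢0

  coeff-zero : ∀ f i → All (_≡ 0ₚ) f → coeff f i ≡ 0ₚ
  coeff-zero []      i       []        = ≡.refl
  coeff-zero (a ∷ f) zero    (a≡0 ∷ _) = a≡0
  coeff-zero (a ∷ f) (suc i) (_ ∷ f≡0) = coeff-zero f i f≡0

  constant : ∀ a f → All (_≡ 0ₚ) f → Constant (a ∷ f)
  constant a f f≡0 = a , λ where
    zero    → ≡.refl
    (suc i) → coeff-zero f i f≡0

  deg-positive : ∀ f → ¬ Constant f → 0 < deg f
  deg-positive []      nonconstant = contradiction (0ₚ , λ where
    zero    → ≡.refl
    (suc i) → ≡.refl) nonconstant
  deg-positive (a ∷ f) nonconstant with all? (_≟ 0ₚ) f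
  ... | yes f≡0 = contradiction (constant a f f≡0) nonconstant
  ... | no  _   = s≤s z≤n

  nonconstant⇒nonzero : ∀ f → ¬ Constant f → ¬ All (_≡ 0ₚ) f
  nonconstant⇒nonzero []      nonconstant []        = ℕ.n≮0 (deg-positive [] nonconstant)
  nonconstant⇒nonzero (a ∷ f) nonconstant (_ ∷ f≡0) = nonconstant (constant a f f≡0)

-- Polynomials over 𝔽 p with range sum p

module RangeSum (q : ℕ) (p-prime : Prime (suc (suc q))) where

  private
    p : ℕ
    p = suc (suc q)

  open ResidueRing p
  open Polynomials commutativeRing
  open Characteristic commutativeRing using (fermat)
  open SemiringExp (CommutativeRing.semiring commutativeRing) using (_^_)
  open SemiringMult (CommutativeRing.semiring commutativeRing) using (_×_; ×-comm-*)
  open RingProperties (CommutativeRing.ring commutativeRing) using (-1*x≈-x; +-inverseˡ-unique)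
  open CommutativeRing commutativeRing using (-‿inverseˡ; *-identityʳ)
  open ≡.≡-Reasoning

  value≡eval : ∀ f x → value f x ≡ eval f x
  value≡eval []      x = ≡.refl
  value≡eval (a ∷ f) x = ≡.cong (λ v → a +ₚ x *ₚ v) (value≡eval f x)

  coefficient≡coeff : ∀ f i → coefficient f i ≡ coeff f i
  coefficient≡coeff []      i       = ≡.refl
  coefficient≡coeff (a ∷ f) zero    = ≡.refl
  coefficient≡coeff (a ∷ f) (suc i) = coefficient≡coeff f i

  all-elements-roots : ∀ x → value (X^p-X q) x ≡ 0ₚ
  all-elements-roots x = value-X^p-X q x
    (≡.subst (λ y → y ^ p ≡ y) (toℕ-×-1 x) (fermat p-prime p×x≡0 (toℕ x)))

  -- (X ^ p - X) / X
  cofactor : 𝔽[X] p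
  cofactor = (-ₚ 1ₚ) ∷ monomial q

  module _ (f : 𝔽[X] p) (f-length : length f ≤ p)
           (f-sum : sum (map (λ x → toℕ (value f x)) (allFin p)) ≡ p) where

    multiplicity : 𝔽 p → ℕ
    multiplicity x = toℕ (value f x)

    roots : List (𝔽 p)
    roots = withMultiplicity multiplicity (allFin p)

    -- Here the hypothesis on the sum of values becomes the degree of F.
    length-roots : length roots ≡ p
    length-roots = ≡.trans (length-withMultiplicity multiplicity (allFin p)) f-sum

    value-quotients : ∀ x → value (quotients cofactor roots) x ≡ -ₚ value f x
    value-quotients x = begin
      value (quotients cofactor roots) x
        ≡⟨ value-quotients-∈ multiplicity cofactor x
             (λ r r≢x → value-quotient (no-zero-divisors p-prime) r 0ₚ cofactor x
               (all-elements-roots r) (all-elements-roots x) r≢x)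
             (allFin⁺ p) (∈-allFin x) ⟩
      multiplicity x × value (quotient x cofactor) x
        ≡⟨ ≡.cong (multiplicity x ×_) (value-quotient-X^p-X q p×x≡0 x) ⟩
      -- An extra factor 1 is inserted so that the multiple can be moved onto it, where `toℕ-×-1`
      -- turns the integer f(x) back into a residue.
      multiplicity x × (-ₚ 1ₚ)
        ≡⟨ ≡.cong (multiplicity x ×_) (*-identityʳ (-ₚ 1ₚ)) ⟨
      multiplicity x × ((-ₚ 1ₚ) *ₚ 1ₚ)
        ≡⟨ ×-comm-* (multiplicity x) (-ₚ 1ₚ) 1ₚ ⟨
      (-ₚ 1ₚ) *ₚ (multiplicity x × 1ₚ)
        ≡⟨ ≡.cong ((-ₚ 1ₚ) *ₚ_) (toℕ-×-1 (value f x)) ⟩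
      (-ₚ 1ₚ) *ₚ value f x
        ≡⟨ -1*x≈-x (value f x) ⟩
      -ₚ value f x ∎

    -- Both lists have length at most p (`cofactor` has exactly q + 2 entries), and their sum
    -- vanishes at all p elements.
    quotients-⊞-zero : All (_≡ 0ₚ) (quotients cofactor roots ⊞ f)
    quotients-⊞-zero = all-roots (no-zero-divisors p-prime) (quotients cofactor roots ⊞ f) (allFin⁺ p)
      (≡.subst (length (quotients cofactor roots ⊞ f) ≤_) (≡.sym (length-tabulate {n = p} (λ x → x)))
        (length-⊞ (quotients cofactor roots) f
          (ℕ.≤-trans (length-quotients cofactor roots) (s≤s (ℕ.≤-reflexive (length-monomial q)))) f-length))
      (All.universal (λ x → ≡.trans (value-⊞ (quotients cofactor roots) f x)
        (≡.trans (≡.cong (_+ₚ value f x) (value-quotients x)) (-‿inverseˡ (value f x)))) (allFin p))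

    equation : ∀ n → (X^p-X q · ∂ (fromRoots roots)) n ≡ -ₚ (f · fromRoots roots) n
    equation n = begin
      (X^p-X q · ∂ (fromRoots roots)) n
        ≡⟨ logarithmicDerivative 0ₚ cofactor roots all-elements-roots n ⟩
      (quotients cofactor roots · fromRoots roots) n
        ≡⟨ +-inverseˡ-unique _ _ (≡.trans (≡.sym (⊞-· (quotients cofactor roots) f (fromRoots roots) n))
             (·-zero (quotients cofactor roots ⊞ f) (fromRoots roots) quotients-⊞-zero n)) ⟩
      -ₚ (f · fromRoots roots) n ∎

    leading-coefficient-zero : ∀ k → 0 < k → length f ≤ suc k → suc (k ℕ.+ k) < p → coeff f k ≡ 0ₚ
    leading-coefficient-zero k 0<k f≤ 2k+1<p = ≡.trans (≡.sym (coefficient≡coeff f k))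
      (top-coefficient-vanishes q (no-zero-divisors p-prime) (×-torsion-free p-prime) (fromRoots roots)
        (≡.subst (λ n → fromRoots roots n ≡ 1ₚ) length-roots (fromRoots-monic roots))
        (λ n p<n → fromRoots-vanishes roots n (≡.subst (_< n) (≡.sym length-roots) p<n))
        f equation k 0<k f≤ 2k+1<p)

-- The degree bound

theorem1p1 : (p : ℕ) .{{_ : NonZero p}} → Prime p → 23 < p →
    (f : 𝔽[X] p) → ¬ Constant f →
    sum (map (λ x → toℕ (eval f x)) (allFin p)) ≡ p →
    deg f ≥ (p ∸ 1) / 2
theorem1p1 zero          _       ()
theorem1p1 (suc zero)    _       (s≤s ())
theorem1p1 (suc (suc q)) p-prime _        f nonconstant f-sum = ℕ.≮⇒≥ λ deg<half →
  let open RangeSum q p-prime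
      k = deg f
      2k+1<p : suc (k ℕ.+ k) < suc (suc q)
      -- Even if the halving rounds down, k + 1 ≤ (p - 1) / 2 gives 2k + 2 ≤ p - 1.
      2k+1<p = ℕ.m≤n⇒m≤1+n (begin
        suc (suc (k ℕ.+ k))   ≡⟨ ≡.cong suc (ℕ.+-suc k k) ⟨
        suc k ℕ.+ suc k       ≡⟨ ≡.cong (suc k ℕ.+_) (ℕ.+-identityʳ (suc k)) ⟨
        2 ℕ.* suc k           ≡⟨ ℕ.*-comm 2 (suc k) ⟩
        suc k ℕ.* 2           ≤⟨ ℕ.*-monoˡ-≤ 2 deg<half ⟩
        suc q / 2 ℕ.* 2       ≤⟨ m/n*n≤m (suc q) 2 ⟩
        suc q                 ∎)
      k<p : suc k ≤ suc (suc q)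
      k<p = ℕ.≤-trans (s≤s (ℕ.m≤m+n k k)) (ℕ.<⇒≤ 2k+1<p)
  -- The coefficient at k of the trimmed list is nonzero by the meaning of degree and zero by the
  -- comparison of coefficients. Trimming preserves values, hence the range sum.
  in trim-leading f (nonconstant⇒nonzero f nonconstant)
       (leading-coefficient-zero (trim f)
         (ℕ.≤-trans (length-trim f) k<p)
         (≡.trans (≡.cong sum (map-cong (λ x → ≡.cong toℕ (≡.trans (value≡eval (trim f) x) (eval-trim f x)))
           (allFin (suc (suc q))))) f-sum)
         k (deg-positive f nonconstant) (length-trim f) 2k+1<p)
  where open ℕ.≤-Reasoning
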